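{- Let $(e_0,S_0)$ be a set foundation and let $(s)_S$ be a set over $(e_0,S_0)$ such that for every element $s_1$ of $(s)_S$ the set $(s_1)_S$ over $(e_0,S_0)$ is non-empty. Then there exist a set $(t)_T$ over $(e_0,S_0)$ and a function $(f)_F:(s)_S\to(t)_T$ such that for every element $s_1$ of $(s)_S$, $(f)_F(s_1)$ is an element of $(s_1)_S$ over $(e_0,S_0)$.
   Context: Base theory: a two-sorted first-order theory with equality whose sorts are words (lower-case variables) and systems (upper-case variables), with two word constants $0$ and $1$, a binary concatenation operation on words written by juxtaposition, and a membership relation $x\in S$ between a word and a system. Axioms: (symbols) $0\neq 1$ and $xy\neq 0$, $xy\neq 1$ for all words $x,y$; (associativity) $(xy)z=x(yz)$; (reading) $x0\neq y1$ for all $x,y$; (simplification) if $x_1y_1=x_2y_2$ and $y_1=y_2$ then $x_1=x_2$; (extensionality) two systems with the same elements are equal; (word induction) every system containing $0$ and $1$ and containing $x0$ and $x1$ whenever it contains $x$ contains every word; (comprehension) for every formula $\phi(x,x_1,\dots,x_n,S_1,\dots,S_m)$ in which $S$ is not free, there is a system $S$ with $x\in S\Leftrightarrow\phi$ for all words $x$. Sets. A system $A$ is right-readable if for all words $x,y$ and all $z_1,z_2\in A$, $xz_1=yz_2$ implies $z_1=z_2$; left-readable if $z_1x=z_2y$ implies $z_1=z_2$; an alphabet if it is both. The system right-generated by a system $A$ is the smallest system containing every element of $A$ and containing $x_2x_1$ whenever $x_1\in A$ and $x_2$ belongs to it; its elements are called words over $A$. Alphabets $A_1,A_2$ are independent if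 $A_1\cup A_2$ is an alphabet and $A_1\cap A_2=\emptyset$; a word $e$ and an alphabet $A$ are independent if the system whose only element is $e$ and $A$ are independent. A nonempty alphabet $A$ is expressive if there exist independent alphabets $B_1,B_2$ all of whose elements are words over $A$. A set foundation is a pair $(e_0,S_0)$ with $S_0$ an expressive alphabet and $e_0$ a word independent of $S_0$. A set over $(e_0,S_0)$ is a pair $(e)_S$ consisting of a system $S$ and a word $e$ over $S_0$; a word $x$ is an element of $(e)_S$ over $(e_0,S_0)$ iff $xe_0e\in S$. For an element $x$ of a set with context system $S$, $(x)_S$ denotes the set with representation $x$ and context system $S$. A set is non-empty if it has at least one element. A set $(e)_E$ associates $x_1$ to $x_2$, written $(e)_E=(x_1,x_2)$, if its elements are exactly $x_1$ and $x_1x_2$; $(x_1,x_2)\in(s)_S$ means some element $y$ of $(s)_S$ satisfies $(y)_S=(x_1,x_2)$. $((a)_A,(b)_B,(c)_C)$ is a relation if each element $c_1$ of $(c)_C$ satisfies $(c_1)_C=(a_1,b_1)$ for some elements $a_1$ of $(a)_A$ and $b_1$ of $(b)_B$, and no two distinct elements $c_1,c_2$ of $(c)_C$ satisfy $(c_1)_C=(c_2)_C=(a_1,b_1)$. A function $(f)_F:(a)_A\to(b)_B$ is such a relation in which every element $a_1$ of $(a)_A$ has some $b_1$ with $(a_1,b_1)\in(f)_F$, and this $b_1$ is unique; we write $(f)_F(a_1)=b_1$. -}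

module Defs where

open import Data.Nat using (ℕ; zero; suc)
open import Data.Product using (Σ; _×_; _,_)
open import Data.Sum using (_⊎_)
open import Data.Empty using (⊥)
open import Relation.Nullary using (¬_)
open import Relation.Binary.PropositionalEquality using (_≡_; _≢_)

infix 2 _⇔_
_⇔_ : Set → Set → Set
A ⇔ B = (A → B) × (B → A)

-- Syntax of the first-order language (de Bruijn indices, two sorts)

data Term : Set where
  var  : ℕ → Term
  zer  : Term
  one  : Term
  _⊙_  : Term → Term → Term

data Formula : Set where
  _≐_    : Term → Term → Formula
  _∈ᵛ_   : Term → ℕ → Formula
  _≐ˢ_   : ℕ → ℕ → Formula
  ⊥ᶠ     : Formula
  _⇒_    : Formula → Formula → Formula
  _∧ᶠ_   : Formula → Formula → Formula
  _∨ᶠ_   : Formula → Formula → Formula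
  ∀w ∃w  : Formula → Formula
  ∀s ∃s  : Formula → Formula

record Structure : Set₁ where
  field
    Word   : Set
    System : Set
    𝟘 𝟙    : Word
    _·_    : Word → Word → Word
    _∈_    : Word → System → Set
  infixl 7 _·_
  infix 4 _∈_

module Semantics (M : Structure) where
  open Structure M

  _∷ₑ_ : {A : Set} → A → (ℕ → A) → ℕ → A
  (a ∷ₑ ρ) zero    = a
  (a ∷ₑ ρ) (suc n) = ρ n

  ⟦_⟧ₜ : Term → (ℕ → Word) → Word
  ⟦ var n ⟧ₜ ρ = ρ n
  ⟦ zer ⟧ₜ ρ = 𝟘
  ⟦ one ⟧ₜ ρ = 𝟙
  ⟦ t ⊙ u ⟧ₜ ρ = ⟦ t ⟧ₜ ρ · ⟦ u ⟧ₜ ρ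

  ⟦_⟧ : Formula → (ℕ → Word) → (ℕ → System) → Set
  ⟦ t ≐ u ⟧ ρ σ = ⟦ t ⟧ₜ ρ ≡ ⟦ u ⟧ₜ ρ
  ⟦ t ∈ᵛ X ⟧ ρ σ = ⟦ t ⟧ₜ ρ ∈ σ X
  ⟦ X ≐ˢ Y ⟧ ρ σ = σ X ≡ σ Y
  ⟦ ⊥ᶠ ⟧ ρ σ = ⊥
  ⟦ φ ⇒ ψ ⟧ ρ σ = ⟦ φ ⟧ ρ σ → ⟦ ψ ⟧ ρ σ
  ⟦ φ ∧ᶠ ψ ⟧ ρ σ = ⟦ φ ⟧ ρ σ × ⟦ ψ ⟧ ρ σ
  ⟦ φ ∨ᶠ ψ ⟧ ρ σ = ⟦ φ ⟧ ρ σ ⊎ ⟦ ψ ⟧ ρ σ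
  ⟦ ∀w φ ⟧ ρ σ = (x : Word) → ⟦ φ ⟧ (x ∷ₑ ρ) σ
  ⟦ ∃w φ ⟧ ρ σ = Σ Word λ x → ⟦ φ ⟧ (x ∷ₑ ρ) σ
  ⟦ ∀s φ ⟧ ρ σ = (X : System) → ⟦ φ ⟧ ρ (X ∷ₑ σ)
  ⟦ ∃s φ ⟧ ρ σ = Σ System λ X → ⟦ φ ⟧ ρ (X ∷ₑ σ)

record Model : Set₁ where
  field
    structure : Structure
  open Structure structure public
  open Semantics structure public
  field
    0≢1      : 𝟘 ≢ 𝟙
    ·≢0      : ∀ x y → x · y ≢ 𝟘
    ·≢1      : ∀ x y → x · y ≢ 𝟙
    assoc    : ∀ x y z → (x · y) · z ≡ x · (y · z)
    reading  : ∀ x y → x · 𝟘 ≢ y · 𝟙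
    simplify : ∀ x₁ y₁ x₂ y₂ → x₁ · y₁ ≡ x₂ · y₂ → y₁ ≡ y₂ → x₁ ≡ x₂
    ext      : ∀ S T → (∀ x → (x ∈ S ⇔ x ∈ T)) → S ≡ T
    induction : ∀ S → 𝟘 ∈ S → 𝟙 ∈ S →
                (∀ x → x ∈ S → (x · 𝟘 ∈ S) × (x · 𝟙 ∈ S)) → ∀ x → x ∈ S
    -- comprehension (schema over first-order formulas): word variable 0
    -- plays the role of x, the environments give the parameters
    comprehension : ∀ (φ : Formula) (ρ : ℕ → Word) (σ : ℕ → System) →
                    Σ System λ S → ∀ x → (x ∈ S ⇔ ⟦ φ ⟧ (x ∷ₑ ρ) σ)

module Sets (M : Model) where
  open Model M public

  RightReadableP : (Word → Set) → Set
  RightReadableP A = ∀ x y z₁ z₂ → A z₁ → A z₂ → x · z₁ ≡ y · z₂ → z₁ ≡ z₂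

  LeftReadableP : (Word → Set) → Set
  LeftReadableP A = ∀ x y z₁ z₂ → A z₁ → A z₂ → z₁ · x ≡ z₂ · y → z₁ ≡ z₂

  AlphabetP : (Word → Set) → Set
  AlphabetP A = RightReadableP A × LeftReadableP A

  Alphabet : System → Set
  Alphabet A = AlphabetP (_∈ A)

  WordOver : System → Word → Set
  WordOver A x = ∀ S → (∀ y → y ∈ A → y ∈ S) →
                 (∀ x₂ x₁ → x₂ ∈ S → x₁ ∈ A → x₂ · x₁ ∈ S) → x ∈ S

  IndependentP : (Word → Set) → (Word → Set) → Set
  IndependentP A₁ A₂ = AlphabetP A₁ × AlphabetP A₂ ×
                       AlphabetP (λ x → A₁ x ⊎ A₂ x) ×
                       (∀ x → A₁ x → A₂ x → ⊥)

  Independent : System → System → Set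
  Independent A₁ A₂ = IndependentP (_∈ A₁) (_∈ A₂)

  IndependentWord : Word → System → Set
  IndependentWord e A = IndependentP (λ x → x ≡ e) (_∈ A)

  Expressive : System → Set
  Expressive A = Alphabet A × (Σ Word λ x → x ∈ A) ×
                 (Σ System λ B₁ → Σ System λ B₂ → Independent B₁ B₂ ×
                    (∀ x → x ∈ B₁ → WordOver A x) × (∀ x → x ∈ B₂ → WordOver A x))

  SetFoundation : Word → System → Set
  SetFoundation e₀ S₀ = Expressive S₀ × IndependentWord e₀ S₀

  module OverFoundation (e₀ : Word) (S₀ : System) where

    record SetOver : Set where
      constructor ⟨_⟩[_]∶_
      field
        rep   : Word
        ctx   : System
        over  : WordOver S₀ rep
    open SetOver public

    Elem : Word → System → Word → Set
    Elem e S x = (x · e₀) · e ∈ S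

    Associates : Word → System → Word → Word → Set
    Associates e E x₁ x₂ = ∀ x → (Elem e E x ⇔ (x ≡ x₁ ⊎ x ≡ x₁ · x₂))

    PairIn : Word → Word → Word → System → Set
    PairIn x₁ x₂ s S = Σ Word λ y → Elem s S y × Associates y S x₁ x₂

    IsRelation : SetOver → SetOver → SetOver → Set
    IsRelation a b c =
      (∀ c₁ → Elem (rep c) (ctx c) c₁ →
         Σ Word λ a₁ → Σ Word λ b₁ →
           Elem (rep a) (ctx a) a₁ × Elem (rep b) (ctx b) b₁ ×
           Associates c₁ (ctx c) a₁ b₁) ×
      (∀ c₁ c₂ a₁ b₁ → Elem (rep c) (ctx c) c₁ → Elem (rep c) (ctx c) c₂ →
         Associates c₁ (ctx c) a₁ b₁ → Associates c₂ (ctx c) a₁ b₁ → c₁ ≡ c₂)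

    IsFunction : SetOver → SetOver → SetOver → Set
    IsFunction f a b =
      IsRelation a b f ×
      (∀ a₁ → Elem (rep a) (ctx a) a₁ →
         (Σ Word λ b₁ → PairIn a₁ b₁ (rep f) (ctx f)) ×
         (∀ b₁ b₂ → PairIn a₁ b₁ (rep f) (ctx f) → PairIn a₁ b₂ (rep f) (ctx f) → b₁ ≡ b₂))

module Submission where

-- Choice functions of the metatheory cannot be used: the graph of the
-- function must be a system, i.e. defined by a first-order formula.  So the
-- chosen element must be definable.  Fix a letter a ∈ S₀ that e₀ separates
-- (no word ending in e₀ ends in a).  The powers a, aa, … play the role of
-- positive integers: they admit induction and, classically, every nonempty
-- system of powers has a least element.  Every word receives a definable
-- code, a power of a (bijective binary numeration), and the coding is
-- injective and functional.  For each element s₁ of (s)_S we choose the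
-- element of (s₁)_S with least code.  The function is the set (a)_F whose
-- elements are the words n · e₀, n the code of some s₁; the pair set
-- (n · e₀)_F has the elements s₁ and s₁ · b with b the chosen element.  The
-- separator e₀ makes words (x · e₀) · n readable, so F can hold both kinds
-- of membership without confusion.

open import Defs
open import Level using (0ℓ)
open import Axiom.ExcludedMiddle using (ExcludedMiddle)
open import Data.Product using (Σ; _×_; _,_; proj₁; proj₂)
open import Data.Sum using (_⊎_; inj₁; inj₂)
open import Data.Empty using (⊥; ⊥-elim)
open import Data.Nat using (ℕ; suc)
open import Function using (_∘_)
open import Relation.Nullary using (yes; no)
open import Relation.Binary.PropositionalEquality using (_≡_; _≢_; refl; sym; trans; cong; subst; module ≡-Reasoning)

-- Basic combinatorics of words, derived from the axioms by word induction.
-- Comprehension needs environments, so an arbitrary system is supplied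
-- to fill the unused system variables.
module WordCombinatorics (M : Model) (anySystem : Model.System M) where
  open Model M

  noWords : ℕ → Word
  noWords _ = 𝟘

  noSystems : ℕ → System
  noSystems _ = anySystem

  -- Word induction for a property expressed by a formula: comprehension
  -- turns the property into a system, to which the induction axiom applies.
  formulaInduction : (φ : Formula) (ρ : ℕ → Word) (σ : ℕ → System) →
    ⟦ φ ⟧ (𝟘 ∷ₑ ρ) σ → ⟦ φ ⟧ (𝟙 ∷ₑ ρ) σ →
    (∀ x → ⟦ φ ⟧ (x ∷ₑ ρ) σ → ⟦ φ ⟧ ((x · 𝟘) ∷ₑ ρ) σ × ⟦ φ ⟧ ((x · 𝟙) ∷ₑ ρ) σ) →
    ∀ x → ⟦ φ ⟧ (x ∷ₑ ρ) σ
  formulaInduction φ ρ σ base₀ base₁ step x with comprehension φ ρ σ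
  ... | S , S⇔φ = proj₁ (S⇔φ x) (induction S (proj₂ (S⇔φ 𝟘) base₀) (proj₂ (S⇔φ 𝟙) base₁) stepS x)
    where
    stepS : ∀ y → y ∈ S → (y · 𝟘 ∈ S) × (y · 𝟙 ∈ S)
    stepS y y∈S with step y (proj₁ (S⇔φ y) y∈S)
    ... | φ₀ , φ₁ = proj₂ (S⇔φ _) φ₀ , proj₂ (S⇔φ _) φ₁

  data LastLetter : Word → Set where
    just𝟘 : LastLetter 𝟘
    just𝟙 : LastLetter 𝟙
    ends𝟘 : ∀ z → LastLetter (z · 𝟘)
    ends𝟙 : ∀ z → LastLetter (z · 𝟙)

  lastLetter : ∀ x → LastLetter x
  lastLetter x = view (shapes x)
    where
    Shape : Word → Set
    Shape x = x ≡ 𝟘 ⊎ x ≡ 𝟙 ⊎ Σ Word (λ z → x ≡ z · 𝟘) ⊎ Σ Word (λ z → x ≡ z · 𝟙)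

    shapes : ∀ x → Shape x
    shapes = formulaInduction
      ((var 0 ≐ zer) ∨ᶠ ((var 0 ≐ one) ∨ᶠ (∃w (var 1 ≐ (var 0 ⊙ zer)) ∨ᶠ ∃w (var 1 ≐ (var 0 ⊙ one)))))
      noWords noSystems (inj₁ refl) (inj₂ (inj₁ refl))
      (λ x _ → inj₂ (inj₂ (inj₁ (x , refl))) , inj₂ (inj₂ (inj₂ (x , refl))))

    view : ∀ {x} → Shape x → LastLetter x
    view (inj₁ refl) = just𝟘
    view (inj₂ (inj₁ refl)) = just𝟙
    view (inj₂ (inj₂ (inj₁ (z , refl)))) = ends𝟘 z
    view (inj₂ (inj₂ (inj₂ (z , refl)))) = ends𝟙 z

  cancelʳ : ∀ x y c → x · c ≡ y · c → x ≡ y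
  cancelʳ x y c eq = simplify x c y c eq refl

  suffixIrrefl : ∀ x y → y · x ≢ x
  suffixIrrefl = formulaInduction (∀w (((var 0 ⊙ var 1) ≐ var 1) ⇒ ⊥ᶠ)) noWords noSystems
    (λ y → ·≢0 y 𝟘) (λ y → ·≢1 y 𝟙)
    (λ x ih → (λ y eq → ih y (cancelʳ (y · x) x 𝟘 (trans (assoc y x 𝟘) eq)))
            , (λ y eq → ih y (cancelʳ (y · x) x 𝟙 (trans (assoc y x 𝟙) eq))))

  prefixIrrefl : ∀ x y → x · y ≢ x
  prefixIrrefl = formulaInduction (∀w (((var 1 ⊙ var 0) ≐ var 1) ⇒ ⊥ᶠ)) noWords noSystems
    (λ y → ·≢0 𝟘 y) (λ y → ·≢1 𝟙 y) (λ x ih → step𝟘 x ih , step𝟙 x ih)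
    where
    step𝟘 : ∀ x → (∀ y → x · y ≢ x) → ∀ y → (x · 𝟘) · y ≢ x · 𝟘
    step𝟘 x ih y eq with lastLetter y
    ... | just𝟘 = ih 𝟘 (cancelʳ (x · 𝟘) x 𝟘 eq)
    ... | just𝟙 = reading x (x · 𝟘) (sym eq)
    ... | ends𝟘 z = ih (𝟘 · z) (trans (sym (assoc x 𝟘 z))
                      (cancelʳ ((x · 𝟘) · z) x 𝟘 (trans (assoc (x · 𝟘) z 𝟘) eq)))
    ... | ends𝟙 z = reading x ((x · 𝟘) · z) (sym (trans (assoc (x · 𝟘) z 𝟙) eq))

    step𝟙 : ∀ x → (∀ y → x · y ≢ x) → ∀ y → (x · 𝟙) · y ≢ x · 𝟙
    step𝟙 x ih y eq with lastLetter y
    ... | just𝟘 = reading (x · 𝟙) x eq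
    ... | just𝟙 = ih 𝟙 (cancelʳ (x · 𝟙) x 𝟙 eq)
    ... | ends𝟘 z = reading ((x · 𝟙) · z) x (trans (assoc (x · 𝟙) z 𝟘) eq)
    ... | ends𝟙 z = ih (𝟙 · z) (trans (sym (assoc x 𝟙 z))
                      (cancelʳ ((x · 𝟙) · z) x 𝟙 (trans (assoc (x · 𝟙) z 𝟙) eq)))

  cancelˡ : ∀ x y y' → x · y ≡ x · y' → y ≡ y'
  cancelˡ x y y' = cancels y y' x
    where
    Cancels : Word → Set
    Cancels y = ∀ y' x → x · y ≡ x · y' → y ≡ y'

    base𝟘 : Cancels 𝟘
    base𝟘 y' x eq with lastLetter y'
    ... | just𝟘 = refl
    ... | just𝟙 = ⊥-elim (reading x x eq)
    ... | ends𝟘 z = ⊥-elim (prefixIrrefl x z (sym (cancelʳ x (x · z) 𝟘 (trans eq (sym (assoc x z 𝟘))))))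
    ... | ends𝟙 z = ⊥-elim (reading x (x · z) (trans eq (sym (assoc x z 𝟙))))

    base𝟙 : Cancels 𝟙
    base𝟙 y' x eq with lastLetter y'
    ... | just𝟘 = ⊥-elim (reading x x (sym eq))
    ... | just𝟙 = refl
    ... | ends𝟘 z = ⊥-elim (reading (x · z) x (sym (trans eq (sym (assoc x z 𝟘)))))
    ... | ends𝟙 z = ⊥-elim (prefixIrrefl x z (sym (cancelʳ x (x · z) 𝟙 (trans eq (sym (assoc x z 𝟙))))))

    step𝟘 : ∀ y → Cancels y → Cancels (y · 𝟘)
    step𝟘 y ih y' x eq with lastLetter y'
    ... | just𝟘 = ⊥-elim (prefixIrrefl x y (cancelʳ (x · y) x 𝟘 (trans (assoc x y 𝟘) eq)))
    ... | just𝟙 = ⊥-elim (reading (x · y) x (trans (assoc x y 𝟘) eq))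
    ... | ends𝟘 z = cong (_· 𝟘) (ih z x (cancelʳ (x · y) (x · z) 𝟘
                      (trans (assoc x y 𝟘) (trans eq (sym (assoc x z 𝟘))))))
    ... | ends𝟙 z = ⊥-elim (reading (x · y) (x · z) (trans (assoc x y 𝟘) (trans eq (sym (assoc x z 𝟙)))))

    step𝟙 : ∀ y → Cancels y → Cancels (y · 𝟙)
    step𝟙 y ih y' x eq with lastLetter y'
    ... | just𝟘 = ⊥-elim (reading x (x · y) (sym (trans (assoc x y 𝟙) eq)))
    ... | just𝟙 = ⊥-elim (prefixIrrefl x y (cancelʳ (x · y) x 𝟙 (trans (assoc x y 𝟙) eq)))
    ... | ends𝟘 z = ⊥-elim (reading (x · z) (x · y) (sym (trans (assoc x y 𝟙) (trans eq (sym (assoc x z 𝟘))))))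
    ... | ends𝟙 z = cong (_· 𝟙) (ih z x (cancelʳ (x · y) (x · z) 𝟙
                      (trans (assoc x y 𝟙) (trans eq (sym (assoc x z 𝟙))))))

    cancels : ∀ y → Cancels y
    cancels = formulaInduction (∀w (∀w (((var 0 ⊙ var 2) ≐ (var 0 ⊙ var 1)) ⇒ (var 2 ≐ var 1))))
      noWords noSystems base𝟘 base𝟙 (λ y ih → step𝟘 y ih , step𝟙 y ih)

-- The positive powers a, aa, aaa, … of a word a behave like the positive
-- natural numbers: they admit induction, commute, are totally ordered by
-- "is a prefix of", and (classically) every nonempty system of powers has
-- a least element.
module Powers (M : Model) (anySystem : Model.System M) (a : Model.Word M) where
  open Model M
  open WordCombinatorics M anySystem

  powersSystem : Σ System λ P → ∀ x →
    (x ∈ P ⇔ ((X : System) → a ∈ X → ((y : Word) → y ∈ X → y · a ∈ X) → x ∈ X))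
  powersSystem = comprehension
    (∀s ((var 1 ∈ᵛ 0) ⇒ ((∀w ((var 0 ∈ᵛ 0) ⇒ ((var 0 ⊙ var 2) ∈ᵛ 0))) ⇒ (var 0 ∈ᵛ 0))))
    (a ∷ₑ noWords) noSystems

  PowerSys : System
  PowerSys = proj₁ powersSystem

  Power : Word → Set
  Power u = u ∈ PowerSys

  powerEnv : ℕ → System
  powerEnv = PowerSys ∷ₑ noSystems

  power-a : Power a
  power-a = proj₂ (proj₂ powersSystem a) (λ X a∈X closed → a∈X)

  power-step : ∀ u → Power u → Power (u · a)
  power-step u pu = proj₂ (proj₂ powersSystem _)
    (λ X a∈X closed → closed u (proj₁ (proj₂ powersSystem u) pu X a∈X closed))

  -- Induction over powers into a system; the step may assume its argument
  -- is a power because we induct into the intersection with the powers.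
  powerInductionSys : ∀ Z → a ∈ Z → (∀ y → Power y → y ∈ Z → y · a ∈ Z) → ∀ u → Power u → u ∈ Z
  powerInductionSys Z a∈Z step u pu
    with comprehension ((var 0 ∈ᵛ 0) ∧ᶠ (var 0 ∈ᵛ 1)) noWords (Z ∷ₑ powerEnv)
  ... | I , I⇔ = proj₁ (proj₁ (I⇔ u) (proj₁ (proj₂ powersSystem u) pu I (proj₂ (I⇔ a) (a∈Z , power-a)) stepI))
    where
    stepI : ∀ y → y ∈ I → y · a ∈ I
    stepI y y∈I with proj₁ (I⇔ y) y∈I
    ... | y∈Z , py = proj₂ (I⇔ _) (step y py y∈Z , power-step y py)

  powerInduction : (φ : Formula) (ρ : ℕ → Word) (σ : ℕ → System) →
    ⟦ φ ⟧ (a ∷ₑ ρ) σ →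
    (∀ y → Power y → ⟦ φ ⟧ (y ∷ₑ ρ) σ → ⟦ φ ⟧ ((y · a) ∷ₑ ρ) σ) →
    ∀ u → Power u → ⟦ φ ⟧ (u ∷ₑ ρ) σ
  powerInduction φ ρ σ base step u pu with comprehension φ ρ σ
  ... | Z , Z⇔φ = proj₁ (Z⇔φ u) (powerInductionSys Z (proj₂ (Z⇔φ a) base)
        (λ y py y∈Z → proj₂ (Z⇔φ _) (step y py (proj₁ (Z⇔φ y) y∈Z))) u pu)

  data PowerView : Word → Set where
    base : PowerView a
    next : ∀ v → Power v → PowerView (v · a)

  powerView : ∀ u → Power u → PowerView u
  powerView u pu = view (proj₂ (powerInduction
    ((var 0 ∈ᵛ 0) ∧ᶠ ((var 0 ≐ var 1) ∨ᶠ ∃w ((var 0 ∈ᵛ 0) ∧ᶠ (var 1 ≐ (var 0 ⊙ var 2)))))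
    (a ∷ₑ noWords) powerEnv (power-a , inj₁ refl)
    (λ y py _ → power-step y py , inj₂ (y , py , refl)) u pu))
    where
    view : ∀ {u} → u ≡ a ⊎ Σ Word (λ v → Power v × u ≡ v · a) → PowerView u
    view (inj₁ refl) = base
    view (inj₂ (v , pv , refl)) = next v pv

  power-· : ∀ u v → Power u → Power v → Power (u · v)
  power-· u v pu = powerInduction ((var 1 ⊙ var 0) ∈ᵛ 0) (u ∷ₑ noWords) powerEnv
    (power-step u pu) (λ y py ih → subst Power (assoc u y a) (power-step _ ih)) v

  a-comm : ∀ u → Power u → u · a ≡ a · u
  a-comm = powerInduction ((var 0 ⊙ var 1) ≐ (var 1 ⊙ var 0)) (a ∷ₑ noWords) powerEnv refl
    (λ y py ih → trans (cong (_· a) ih) (assoc a y a))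

  power-comm : ∀ u v → Power u → Power v → u · v ≡ v · u
  power-comm u v pu = powerInduction ((var 1 ⊙ var 0) ≐ (var 0 ⊙ var 1)) (u ∷ₑ noWords) powerEnv
    (a-comm u pu) step v
    where
    open ≡-Reasoning
    step : ∀ y → Power y → u · y ≡ y · u → u · (y · a) ≡ (y · a) · u
    step y py ih = begin
      u · (y · a)   ≡⟨ sym (assoc u y a) ⟩
      (u · y) · a   ≡⟨ cong (_· a) ih ⟩
      (y · u) · a   ≡⟨ assoc y u a ⟩
      y · (u · a)   ≡⟨ cong (y ·_) (a-comm u pu) ⟩
      y · (a · u)   ≡⟨ sym (assoc y a u) ⟩
      (y · a) · u   ∎

  endsIn-a : ∀ m → Power m → ∀ z → Σ Word λ z' → z · m ≡ z' · a
  endsIn-a m pm z with powerView m pm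
  ... | base = z , refl
  ... | next v _ = z · v , sym (assoc z v a)

  trichotomy : ∀ u → Power u → ∀ v → Power v →
    u ≡ v ⊎ (Σ Word λ t → Power t × v ≡ u · t) ⊎ (Σ Word λ t → Power t × u ≡ v · t)
  trichotomy = powerInduction
    (∀w ((var 0 ∈ᵛ 0) ⇒ ((var 1 ≐ var 0) ∨ᶠ ((∃w ((var 0 ∈ᵛ 0) ∧ᶠ (var 1 ≐ (var 2 ⊙ var 0))))
                                           ∨ᶠ (∃w ((var 0 ∈ᵛ 0) ∧ᶠ (var 2 ≐ (var 1 ⊙ var 0))))))))
    noWords powerEnv base-case step
    where
    base-case : ∀ v → Power v → a ≡ v ⊎ (Σ Word λ t → Power t × v ≡ a · t) ⊎ (Σ Word λ t → Power t × a ≡ v · t)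
    base-case v pv with powerView v pv
    ... | base = inj₁ refl
    ... | next y py = inj₂ (inj₁ (y , py , a-comm y py))

    step : ∀ y → Power y →
      (∀ v → Power v → y ≡ v ⊎ (Σ Word λ t → Power t × v ≡ y · t) ⊎ (Σ Word λ t → Power t × y ≡ v · t)) →
      ∀ v → Power v → y · a ≡ v ⊎ (Σ Word λ t → Power t × v ≡ (y · a) · t) ⊎ (Σ Word λ t → Power t × y · a ≡ v · t)
    step y py ih v pv with ih v pv
    ... | inj₁ refl = inj₂ (inj₂ (a , power-a , refl))
    ... | inj₂ (inj₂ (t , pt , refl)) = inj₂ (inj₂ (t · a , power-step t pt , assoc v t a))
    ... | inj₂ (inj₁ (t , pt , refl)) with powerView t pt
    ...   | base = inj₁ refl
    ...   | next t' pt' = inj₂ (inj₁ (t' , pt' , trans (cong (y ·_) (a-comm t' pt')) (sym (assoc y a t'))))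

  _≼_ : Word → Word → Set
  n ≼ m = m ≡ n ⊎ Σ Word λ t → Power t × m ≡ n · t

  ≼-antisym : ∀ n m → n ≼ m → m ≼ n → n ≡ m
  ≼-antisym n m (inj₁ eq) _ = sym eq
  ≼-antisym n m (inj₂ _) (inj₁ eq) = eq
  ≼-antisym n m (inj₂ (t , _ , eq)) (inj₂ (t' , _ , eq')) =
    ⊥-elim (prefixIrrefl n (t · t') (sym (trans eq' (trans (cong (_· t') eq) (assoc n t t')))))

  a-≼ : ∀ m → Power m → a ≼ m
  a-≼ m pm with powerView m pm
  ... | base = inj₁ refl
  ... | next y py = inj₂ (y , py , a-comm y py)

  ≼-a : ∀ v → v ≼ a → v ≡ a
  ≼-a v (inj₁ eq) = sym eq
  ≼-a v (inj₂ (t , pt , eq)) with powerView t pt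
  ... | base = ⊥-elim (suffixIrrefl a v (sym eq))
  ... | next t' _ = ⊥-elim (suffixIrrefl a (v · t') (sym (trans eq (sym (assoc v t' a)))))

  ≼-step : ∀ v u → v ≼ (u · a) → v ≼ u ⊎ v ≡ u · a
  ≼-step v u (inj₁ eq) = inj₂ (sym eq)
  ≼-step v u (inj₂ (t , pt , eq)) with powerView t pt
  ... | base = inj₁ (inj₁ (cancelʳ u v a eq))
  ... | next t' pt' = inj₁ (inj₂ (t' , pt' , cancelʳ u (v · t') a (trans eq (sym (assoc v t' a)))))

  -- Least element principle.  It is proved classically: if there were no
  -- least element, induction would show that nothing below any power lies
  -- in X.
  leastElement : ExcludedMiddle 0ℓ → ∀ X → (∀ x → x ∈ X → Power x) → Σ Word (_∈ X) →
    Σ Word λ n₀ → n₀ ∈ X × (∀ m → m ∈ X → n₀ ≼ m)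
  leastElement em X X⊆P (x , x∈X) with em {Σ Word λ n₀ → n₀ ∈ X × (∀ m → m ∈ X → n₀ ≼ m)}
  ... | yes least = least
  ... | no noLeast = ⊥-elim (nothingBelow x (X⊆P x x∈X) x (inj₁ refl) x∈X)
    where
    nothingBelow : ∀ u → Power u → ∀ v → v ≼ u → v ∈ X → ⊥
    nothingBelow = powerInduction
      (∀w (((var 1 ≐ var 0) ∨ᶠ ∃w ((var 0 ∈ᵛ 0) ∧ᶠ (var 2 ≐ (var 1 ⊙ var 0)))) ⇒ ((var 0 ∈ᵛ 1) ⇒ ⊥ᶠ)))
      noWords (PowerSys ∷ₑ (X ∷ₑ noSystems)) base-case step
      where
      base-case : ∀ v → v ≼ a → v ∈ X → ⊥
      base-case v v≼a v∈X with ≼-a v v≼a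
      ... | refl = noLeast (a , v∈X , λ m m∈X → a-≼ m (X⊆P m m∈X))

      step : ∀ y → Power y → (∀ v → v ≼ y → v ∈ X → ⊥) → ∀ v → v ≼ (y · a) → v ∈ X → ⊥
      step y py ih v v≼ v∈X with ≼-step v y v≼
      ... | inj₁ v≼y = ih v v≼y v∈X
      ... | inj₂ refl = noLeast (y · a , v∈X , isLeast)
        where
        isLeast : ∀ m → m ∈ X → (y · a) ≼ m
        isLeast m m∈X with trichotomy (y · a) (power-step y py) m (X⊆P m m∈X)
        ... | inj₁ eq = inj₁ (sym eq)
        ... | inj₂ (inj₁ above) = inj₂ above
        ... | inj₂ (inj₂ below) with ≼-step m y (inj₂ below)
        ...   | inj₁ m≼y = ⊥-elim (ih m m≼y m∈X)
        ...   | inj₂ eq = inj₁ eq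

  -- Squares of powers: (xt)(xt) = (xx)(tt), so squaring is injective and
  -- no square is a square followed by a, nor a itself.
  square-· : ∀ x t → Power x → Power t → (x · t) · (x · t) ≡ (x · x) · (t · t)
  square-· x t px pt = begin
    (x · t) · (x · t)   ≡⟨ assoc x t (x · t) ⟩
    x · (t · (x · t))   ≡⟨ cong (x ·_) (sym (assoc t x t)) ⟩
    x · ((t · x) · t)   ≡⟨ cong (λ w → x · (w · t)) (power-comm t x pt px) ⟩
    x · ((x · t) · t)   ≡⟨ cong (x ·_) (assoc x t t) ⟩
    x · (x · (t · t))   ≡⟨ sym (assoc x x (t · t)) ⟩
    (x · x) · (t · t)   ∎
    where open ≡-Reasoning

  square-injective : ∀ v v' → Power v → Power v' → v · v ≡ v' · v' → v ≡ v'
  square-injective v v' pv pv' eq with trichotomy v pv v' pv'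
  ... | inj₁ same = same
  ... | inj₂ (inj₁ (t , pt , refl)) = ⊥-elim (prefixIrrefl (v · v) (t · t) (sym (trans eq (square-· v t pv pt))))
  ... | inj₂ (inj₂ (t , pt , refl)) = ⊥-elim (prefixIrrefl (v' · v') (t · t) (trans (sym (square-· v' t pv' pt)) eq))

  square≢square·a : ∀ v v' → Power v → Power v' → v · v ≢ (v' · v') · a
  square≢square·a v v' pv pv' eq with trichotomy v pv v' pv'
  ... | inj₁ refl = prefixIrrefl (v · v) a (sym eq)
  ... | inj₂ (inj₁ (t , pt , refl)) = prefixIrrefl (v · v) ((t · t) · a)
         (sym (trans eq (trans (cong (_· a) (square-· v t pv pt)) (assoc (v · v) (t · t) a))))
  ... | inj₂ (inj₂ (t , pt , refl))
    with powerView t pt | cancelˡ (v' · v') (t · t) a (trans (sym (square-· v' t pv' pt)) eq)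
  ...   | base | tt≡a = suffixIrrefl a a tt≡a
  ...   | next t' _ | tt≡a = suffixIrrefl a ((t' · a) · t') (trans (assoc (t' · a) t' a) tt≡a)

  a≢square : ∀ v → Power v → a ≢ v · v
  a≢square v pv eq with powerView v pv
  ... | base = suffixIrrefl a a (sym eq)
  ... | next u _ = suffixIrrefl a (v · u) (sym (trans eq (sym (assoc v u a))))

Separates : (M : Model) → Model.Word M → Model.Word M → Set
Separates M e a = let open Model M in ∀ x y → x · e ≢ y · a

-- A definable coding of all words by powers of a, in bijective binary
-- numeration: 𝟘 ↦ a, 𝟙 ↦ aa, w𝟘 ↦ vva and w𝟙 ↦ vvaa when w ↦ v.  The
-- coding relation is a system H of words (w · e) · n; the separator e
-- makes such a word readable, i.e. determines both w and n.
module Coding (M : Model) (anySystem : Model.System M) (a e : Model.Word M)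
              (sep : Separates M e a) where
  open Model M
  open WordCombinatorics M anySystem
  open Powers M anySystem a

  -- The power following a separator e is determined: (x · e) · n = (x' · e) · n'
  -- forces n = n', since whichever is longer would place e right before a.
  powerAfterSeparator : ∀ n → Power n → ∀ n' x x' → Power n' → (x · e) · n ≡ (x' · e) · n' → n ≡ n'
  powerAfterSeparator = powerInduction
    (∀w (∀w (∀w ((var 2 ∈ᵛ 0) ⇒ ((((var 1 ⊙ var 4) ⊙ var 3) ≐ ((var 0 ⊙ var 4) ⊙ var 2)) ⇒ (var 3 ≐ var 2))))))
    (e ∷ₑ noWords) powerEnv base-case step
    where
    base-case : ∀ n' x x' → Power n' → (x · e) · a ≡ (x' · e) · n' → a ≡ n'
    base-case n' x x' pn' eq with powerView n' pn'
    ... | base = refl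
    ... | next v pv with endsIn-a v pv (x' · e)
    ...   | z' , x'ev≡z'a = ⊥-elim (sep x z' (trans
            (cancelʳ (x · e) ((x' · e) · v) a (trans eq (sym (assoc (x' · e) v a)))) x'ev≡z'a))

    step : ∀ y → Power y → (∀ n' x x' → Power n' → (x · e) · y ≡ (x' · e) · n' → y ≡ n') →
           ∀ n' x x' → Power n' → (x · e) · (y · a) ≡ (x' · e) · n' → y · a ≡ n'
    step y py ih n' x x' pn' eq with powerView n' pn'
    ... | base with endsIn-a y py (x · e)
    ...   | z' , xey≡z'a = ⊥-elim (sep x' z' (trans
            (sym (cancelʳ ((x · e) · y) (x' · e) a (trans (assoc (x · e) y a) eq))) xey≡z'a))
    step y py ih n' x x' pn' eq | next v pv = cong (_· a) (ih v x x' pv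
      (cancelʳ ((x · e) · y) ((x' · e) · v) a (trans (assoc (x · e) y a) (trans eq (sym (assoc (x' · e) v a))))))

  readCoded : ∀ w w' n n' → Power n → Power n' → (w · e) · n ≡ (w' · e) · n' → w ≡ w' × n ≡ n'
  readCoded w w' n n' pn pn' eq with powerAfterSeparator n pn n' w w' pn' eq
  ... | refl = cancelʳ w w' e (cancelʳ (w · e) (w' · e) n eq) , refl

  CodeClosed : System → Set
  CodeClosed X = (w v : Word) → Power v → (w · e) · v ∈ X →
    ((((w · 𝟘) · e) · ((v · v) · a)) ∈ X) × ((((w · 𝟙) · e) · (((v · v) · a) · a)) ∈ X)

  codeSystem : Σ System λ H → ∀ x →
    (x ∈ H ⇔ ((X : System) → (𝟘 · e) · a ∈ X → (𝟙 · e) · (a · a) ∈ X → CodeClosed X → x ∈ X))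
  codeSystem = comprehension
    (∀s ((((zer ⊙ var 1) ⊙ var 2) ∈ᵛ 0) ⇒ ((((one ⊙ var 1) ⊙ (var 2 ⊙ var 2)) ∈ᵛ 0) ⇒
      ((∀w (∀w ((var 0 ∈ᵛ 1) ⇒ ((((var 1 ⊙ var 3) ⊙ var 0) ∈ᵛ 0) ⇒
         (((((var 1 ⊙ zer) ⊙ var 3) ⊙ ((var 0 ⊙ var 0) ⊙ var 4)) ∈ᵛ 0) ∧ᶠ
          ((((var 1 ⊙ one) ⊙ var 3) ⊙ (((var 0 ⊙ var 0) ⊙ var 4) ⊙ var 4)) ∈ᵛ 0)))))) ⇒ (var 0 ∈ᵛ 0)))))
    (e ∷ₑ (a ∷ₑ noWords)) powerEnv

  H : System
  H = proj₁ codeSystem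

  codeEnv : ℕ → System
  codeEnv = PowerSys ∷ₑ (H ∷ₑ noSystems)

  H-𝟘 : (𝟘 · e) · a ∈ H
  H-𝟘 = proj₂ (proj₂ codeSystem _) (λ X x₀ x₁ closed → x₀)

  H-𝟙 : (𝟙 · e) · (a · a) ∈ H
  H-𝟙 = proj₂ (proj₂ codeSystem _) (λ X x₀ x₁ closed → x₁)

  H-closed : CodeClosed H
  H-closed w v pv h =
      proj₂ (proj₂ codeSystem _) (λ X x₀ x₁ closed → proj₁ (closed w v pv (inH X x₀ x₁ closed)))
    , proj₂ (proj₂ codeSystem _) (λ X x₀ x₁ closed → proj₂ (closed w v pv (inH X x₀ x₁ closed)))
    where
    inH : (X : System) → (𝟘 · e) · a ∈ X → (𝟙 · e) · (a · a) ∈ X → CodeClosed X → (w · e) · v ∈ X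
    inH = proj₁ (proj₂ codeSystem _) h

  HRule : Word → Set
  HRule h = h ≡ (𝟘 · e) · a ⊎ h ≡ (𝟙 · e) · (a · a) ⊎
    Σ Word λ w → Σ Word λ v → Power v × (w · e) · v ∈ H ×
      (h ≡ ((w · 𝟘) · e) · ((v · v) · a) ⊎ h ≡ ((w · 𝟙) · e) · (((v · v) · a) · a))

  HShape : Word → Set
  HShape h = h ∈ H × HRule h

  H-inversion : ∀ h → h ∈ H → HShape h
  H-inversion h h∈H
    with comprehension ((var 0 ∈ᵛ 1) ∧ᶠ ((var 0 ≐ ((zer ⊙ var 1) ⊙ var 2)) ∨ᶠ ((var 0 ≐ ((one ⊙ var 1) ⊙ (var 2 ⊙ var 2))) ∨ᶠ
      ∃w (∃w ((var 0 ∈ᵛ 0) ∧ᶠ ((((var 1 ⊙ var 3) ⊙ var 0) ∈ᵛ 1) ∧ᶠ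
        ((var 2 ≐ (((var 1 ⊙ zer) ⊙ var 3) ⊙ ((var 0 ⊙ var 0) ⊙ var 4))) ∨ᶠ
         (var 2 ≐ (((var 1 ⊙ one) ⊙ var 3) ⊙ (((var 0 ⊙ var 0) ⊙ var 4) ⊙ var 4))))))))))
      (e ∷ₑ (a ∷ₑ noWords)) codeEnv
  ... | Z , Z⇔ = proj₁ (Z⇔ h) (proj₁ (proj₂ codeSystem h) h∈H Z
        (proj₂ (Z⇔ _) (H-𝟘 , inj₁ refl)) (proj₂ (Z⇔ _) (H-𝟙 , inj₂ (inj₁ refl))) closedZ)
    where
    closedZ : CodeClosed Z
    closedZ w v pv z with proj₁ (proj₁ (Z⇔ _) z)
    ... | c = proj₂ (Z⇔ _) (proj₁ (H-closed w v pv c) , inj₂ (inj₂ (w , v , pv , c , inj₁ refl)))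
            , proj₂ (Z⇔ _) (proj₂ (H-closed w v pv c) , inj₂ (inj₂ (w , v , pv , c , inj₂ refl)))

  Code : Word → Word → Set
  Code w n = Power n × (w · e) · n ∈ H

  power-aa : Power (a · a)
  power-aa = power-· a a power-a power-a

  power-vva : ∀ v → Power v → Power ((v · v) · a)
  power-vva v pv = power-step _ (power-· v v pv pv)

  data CodeShape : Word → Word → Set where
    code𝟘  : CodeShape 𝟘 a
    code𝟙  : CodeShape 𝟙 (a · a)
    code·𝟘 : ∀ w v → Code w v → CodeShape (w · 𝟘) ((v · v) · a)
    code·𝟙 : ∀ w v → Code w v → CodeShape (w · 𝟙) (((v · v) · a) · a)

  codeShape : ∀ w n → Code w n → CodeShape w n
  codeShape w n (pn , c) = shape (proj₂ (H-inversion _ c))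
    where
    along : ∀ {w' n'} → w ≡ w' × n ≡ n' → CodeShape w' n' → CodeShape w n
    along (refl , refl) s = s

    shape : HRule ((w · e) · n) → CodeShape w n
    shape (inj₁ eq) = along (readCoded w 𝟘 n a pn power-a eq) code𝟘
    shape (inj₂ (inj₁ eq)) = along (readCoded w 𝟙 n (a · a) pn power-aa eq) code𝟙
    shape (inj₂ (inj₂ (w₁ , v , pv , cv , inj₁ eq))) =
      along (readCoded w (w₁ · 𝟘) n _ pn (power-vva v pv) eq) (code·𝟘 w₁ v (pv , cv))
    shape (inj₂ (inj₂ (w₁ , v , pv , cv , inj₂ eq))) =
      along (readCoded w (w₁ · 𝟙) n _ pn (power-step _ (power-vva v pv)) eq) (code·𝟙 w₁ v (pv , cv))

  code-𝟘 : ∀ n → Code 𝟘 n → n ≡ a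
  code-𝟘 n c = from (codeShape 𝟘 n c) refl
    where
    from : ∀ {w n} → CodeShape w n → w ≡ 𝟘 → n ≡ a
    from code𝟘 _ = refl
    from code𝟙 eq = ⊥-elim (0≢1 (sym eq))
    from (code·𝟘 w₁ _ _) eq = ⊥-elim (·≢0 w₁ 𝟘 eq)
    from (code·𝟙 w₁ _ _) eq = ⊥-elim (·≢0 w₁ 𝟙 eq)

  code-𝟙 : ∀ n → Code 𝟙 n → n ≡ a · a
  code-𝟙 n c = from (codeShape 𝟙 n c) refl
    where
    from : ∀ {w n} → CodeShape w n → w ≡ 𝟙 → n ≡ a · a
    from code𝟘 eq = ⊥-elim (0≢1 eq)
    from code𝟙 _ = refl
    from (code·𝟘 w₁ _ _) eq = ⊥-elim (·≢1 w₁ 𝟘 eq)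
    from (code·𝟙 w₁ _ _) eq = ⊥-elim (·≢1 w₁ 𝟙 eq)

  code-·𝟘 : ∀ w n → Code (w · 𝟘) n → Σ Word λ v → Code w v × n ≡ (v · v) · a
  code-·𝟘 w n c = from (codeShape (w · 𝟘) n c) refl
    where
    from : ∀ {w' n} → CodeShape w' n → w' ≡ w · 𝟘 → Σ Word λ v → Code w v × n ≡ (v · v) · a
    from code𝟘 eq = ⊥-elim (·≢0 w 𝟘 (sym eq))
    from code𝟙 eq = ⊥-elim (·≢1 w 𝟘 (sym eq))
    from (code·𝟘 w₁ v cv) eq = v , subst (λ k → Code k v) (cancelʳ w₁ w 𝟘 eq) cv , refl
    from (code·𝟙 w₁ _ _) eq = ⊥-elim (reading w w₁ (sym eq))

  code-·𝟙 : ∀ w n → Code (w · 𝟙) n → Σ Word λ v → Code w v × n ≡ ((v · v) · a) · a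
  code-·𝟙 w n c = from (codeShape (w · 𝟙) n c) refl
    where
    from : ∀ {w' n} → CodeShape w' n → w' ≡ w · 𝟙 → Σ Word λ v → Code w v × n ≡ ((v · v) · a) · a
    from code𝟘 eq = ⊥-elim (·≢0 w 𝟙 (sym eq))
    from code𝟙 eq = ⊥-elim (·≢1 w 𝟙 (sym eq))
    from (code·𝟘 w₁ _ _) eq = ⊥-elim (reading w₁ w eq)
    from (code·𝟙 w₁ v cv) eq = v , subst (λ k → Code k v) (cancelʳ w₁ w 𝟙 eq) cv , refl

  codeTotal : ∀ w → Σ Word (Code w)
  codeTotal = formulaInduction (∃w ((var 0 ∈ᵛ 0) ∧ᶠ (((var 1 ⊙ var 2) ⊙ var 0) ∈ᵛ 1))) (e ∷ₑ noWords) codeEnv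
    (a , power-a , H-𝟘) (a · a , power-aa , H-𝟙) step
    where
    step : ∀ w → Σ Word (Code w) → Σ Word (Code (w · 𝟘)) × Σ Word (Code (w · 𝟙))
    step w (v , pv , c) = ((v · v) · a , power-vva v pv , proj₁ (H-closed w v pv c))
                        , (((v · v) · a) · a , power-step _ (power-vva v pv) , proj₂ (H-closed w v pv c))

  codeFunctional : ∀ w n n' → Code w n → Code w n' → n ≡ n'
  codeFunctional = formulaInduction
    (∀w (∀w (((var 1 ∈ᵛ 0) ∧ᶠ (((var 2 ⊙ var 3) ⊙ var 1) ∈ᵛ 1)) ⇒
             (((var 0 ∈ᵛ 0) ∧ᶠ (((var 2 ⊙ var 3) ⊙ var 0) ∈ᵛ 1)) ⇒ (var 1 ≐ var 0)))))
    (e ∷ₑ noWords) codeEnv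
    (λ n n' c c' → trans (code-𝟘 n c) (sym (code-𝟘 n' c')))
    (λ n n' c c' → trans (code-𝟙 n c) (sym (code-𝟙 n' c')))
    (λ w ih → step𝟘 w ih , step𝟙 w ih)
    where
    step𝟘 : ∀ w → (∀ n n' → Code w n → Code w n' → n ≡ n') →
            ∀ n n' → Code (w · 𝟘) n → Code (w · 𝟘) n' → n ≡ n'
    step𝟘 w ih n n' c c' with code-·𝟘 w n c | code-·𝟘 w n' c'
    ... | v , cv , refl | v' , cv' , refl = cong (λ k → (k · k) · a) (ih v v' cv cv')

    step𝟙 : ∀ w → (∀ n n' → Code w n → Code w n' → n ≡ n') →
            ∀ n n' → Code (w · 𝟙) n → Code (w · 𝟙) n' → n ≡ n'
    step𝟙 w ih n n' c c' with code-·𝟙 w n c | code-·𝟙 w n' c'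
    ... | v , cv , refl | v' , cv' , refl = cong (λ k → ((k · k) · a) · a) (ih v v' cv cv')

  -- Distinct words have distinct codes: the four shapes of codes have
  -- lengths 1, 2, odd ≥ 3 and even ≥ 4, and squaring is injective.
  codeInjective : ∀ w w' n → Code w n → Code w' n → w ≡ w'
  codeInjective = formulaInduction
    (∀w (∀w (((var 0 ∈ᵛ 0) ∧ᶠ (((var 2 ⊙ var 3) ⊙ var 0) ∈ᵛ 1)) ⇒
             (((var 0 ∈ᵛ 0) ∧ᶠ (((var 1 ⊙ var 3) ⊙ var 0) ∈ᵛ 1)) ⇒ (var 2 ≐ var 1)))))
    (e ∷ₑ noWords) codeEnv base𝟘 base𝟙 (λ w ih → step𝟘 w ih , step𝟙 w ih)
    where
    Decodes : Word → Set
    Decodes w = ∀ w' n → Code w n → Code w' n → w ≡ w'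

    base𝟘 : Decodes 𝟘
    base𝟘 w' n c c' with code-𝟘 n c | codeShape w' n c'
    ... | _ | code𝟘 = refl
    ... | aa≡a | code𝟙 = ⊥-elim (suffixIrrefl a a aa≡a)
    ... | vva≡a | code·𝟘 _ v _ = ⊥-elim (suffixIrrefl a (v · v) vva≡a)
    ... | vvaa≡a | code·𝟙 _ v _ = ⊥-elim (suffixIrrefl a ((v · v) · a) vvaa≡a)

    base𝟙 : Decodes 𝟙
    base𝟙 w' n c c' with code-𝟙 n c | codeShape w' n c'
    ... | a≡aa | code𝟘 = ⊥-elim (suffixIrrefl a a (sym a≡aa))
    ... | _ | code𝟙 = refl
    ... | vva≡aa | code·𝟘 _ v cv = ⊥-elim (a≢square v (proj₁ cv) (sym (cancelʳ (v · v) a a vva≡aa)))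
    ... | vvaa≡aa | code·𝟙 _ v _ = ⊥-elim (suffixIrrefl a (v · v) (cancelʳ ((v · v) · a) a a vvaa≡aa))

    step𝟘 : ∀ w → Decodes w → Decodes (w · 𝟘)
    step𝟘 w ih w' n c c' with code-·𝟘 w n c | codeShape w' n c'
    ... | v , _ , a≡vva | code𝟘 = ⊥-elim (suffixIrrefl a (v · v) (sym a≡vva))
    ... | v , cv , aa≡vva | code𝟙 = ⊥-elim (a≢square v (proj₁ cv) (cancelʳ a (v · v) a aa≡vva))
    ... | v , cv , eq | code·𝟘 w₁ v' cv' =
      cong (_· 𝟘) (ih w₁ v cv (subst (Code w₁) sameV cv'))
      where
      sameV : v' ≡ v
      sameV = square-injective v' v (proj₁ cv') (proj₁ cv) (cancelʳ (v' · v') (v · v) a eq)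
    ... | v , cv , eq | code·𝟙 w₁ v' cv' =
      ⊥-elim (square≢square·a v v' (proj₁ cv) (proj₁ cv') (sym (cancelʳ ((v' · v') · a) (v · v) a eq)))

    step𝟙 : ∀ w → Decodes w → Decodes (w · 𝟙)
    step𝟙 w ih w' n c c' with code-·𝟙 w n c | codeShape w' n c'
    ... | v , _ , a≡vvaa | code𝟘 = ⊥-elim (suffixIrrefl a ((v · v) · a) (sym a≡vvaa))
    ... | v , _ , aa≡vvaa | code𝟙 = ⊥-elim (suffixIrrefl a (v · v) (sym (cancelʳ a ((v · v) · a) a aa≡vvaa)))
    ... | v , cv , eq | code·𝟘 w₁ v' cv' =
      ⊥-elim (square≢square·a v' v (proj₁ cv') (proj₁ cv) (cancelʳ (v' · v') ((v · v) · a) a eq))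
    ... | v , cv , eq | code·𝟙 w₁ v' cv' =
      cong (_· 𝟙) (ih w₁ v cv (subst (Code w₁) sameV cv'))
      where
      sameV : v' ≡ v
      sameV = square-injective v' v (proj₁ cv') (proj₁ cv)
        (cancelʳ (v' · v') (v · v) a (cancelʳ ((v' · v') · a) ((v · v) · a) a eq))

-- A pair set determines its components: if (c)_E associates x₁ to x₂ and
-- y₁ to y₂, then x₁ = y₁ (otherwise one would be a proper prefix of the
-- other) and hence x₂ = y₂.
module PairSets (M : Model) (e₀ : Model.Word M) (S₀ : Model.System M) where
  open Sets M
  open OverFoundation e₀ S₀
  open WordCombinatorics M S₀

  associatesUnique : ∀ {c E x₁ x₂ y₁ y₂} → Associates c E x₁ x₂ → Associates c E y₁ y₂ →
                     x₁ ≡ y₁ × x₂ ≡ y₂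
  associatesUnique {x₁ = x₁} {x₂ = x₂} {y₁ = y₁} {y₂ = y₂} A B = sameFirst , sameSecond sameFirst x₁x₂∈B
    where
    x₁∈B : x₁ ≡ y₁ ⊎ x₁ ≡ y₁ · y₂
    x₁∈B = proj₁ (B x₁) (proj₂ (A x₁) (inj₁ refl))

    y₁∈A : y₁ ≡ x₁ ⊎ y₁ ≡ x₁ · x₂
    y₁∈A = proj₁ (A y₁) (proj₂ (B y₁) (inj₁ refl))

    x₁x₂∈B : x₁ · x₂ ≡ y₁ ⊎ x₁ · x₂ ≡ y₁ · y₂
    x₁x₂∈B = proj₁ (B (x₁ · x₂)) (proj₂ (A (x₁ · x₂)) (inj₂ refl))

    firstFrom : x₁ ≡ y₁ ⊎ x₁ ≡ y₁ · y₂ → y₁ ≡ x₁ ⊎ y₁ ≡ x₁ · x₂ → x₁ ≡ y₁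
    firstFrom (inj₁ eq) _ = eq
    firstFrom (inj₂ eq) (inj₁ eq') = ⊥-elim (prefixIrrefl x₁ y₂ (sym (trans eq (cong (_· y₂) eq'))))
    firstFrom (inj₂ eq) (inj₂ eq') =
      ⊥-elim (prefixIrrefl x₁ (x₂ · y₂) (sym (trans eq (trans (cong (_· y₂) eq') (assoc x₁ x₂ y₂)))))

    sameFirst : x₁ ≡ y₁
    sameFirst = firstFrom x₁∈B y₁∈A

    sameSecond : x₁ ≡ y₁ → x₁ · x₂ ≡ y₁ ⊎ x₁ · x₂ ≡ y₁ · y₂ → x₂ ≡ y₂
    sameSecond x₁≡y₁ (inj₁ eq) = ⊥-elim (prefixIrrefl x₁ x₂ (trans eq (sym x₁≡y₁)))
    sameSecond x₁≡y₁ (inj₂ eq) = cancelˡ x₁ x₂ y₂ (trans eq (cong (_· y₂) (sym x₁≡y₁)))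

-- A set foundation provides a letter a of S₀ which e₀ separates, by
-- readability of {e₀} ∪ S₀ and disjointness.
foundationLetter : (M : Model) → let open Sets M in
  ∀ e₀ S₀ → SetFoundation e₀ S₀ → Σ Word λ a → a ∈ S₀ × Separates M e₀ a
foundationLetter M e₀ S₀ ((_ , (a , a∈S₀) , _) , (_ , _ , (unionReadable , _) , disjoint)) =
  a , a∈S₀ , λ x y eq → disjoint a (sym (unionReadable x y e₀ a (inj₁ refl) (inj₂ a∈S₀) eq)) a∈S₀

-- Elements of a
-- set are chosen by least code, which makes the choice definable, so the
-- graph of the choice function is a system by comprehension.
module Selection (M : Model) (em : ExcludedMiddle 0ℓ) (e₀ : Model.Word M) (S₀ : Model.System M)
                 (foundation : Sets.SetFoundation M e₀ S₀) where
  open Sets M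
  open OverFoundation e₀ S₀

  a : Word
  a = proj₁ (foundationLetter M e₀ S₀ foundation)

  a∈S₀ : a ∈ S₀
  a∈S₀ = proj₁ (proj₂ (foundationLetter M e₀ S₀ foundation))

  e₀-separates-a : Separates M e₀ a
  e₀-separates-a = proj₂ (proj₂ (foundationLetter M e₀ S₀ foundation))

  open WordCombinatorics M S₀
  open Powers M S₀ a
  open Coding M S₀ a e₀ e₀-separates-a
  open PairSets M e₀ S₀

  overA : WordOver S₀ a
  overA Z S₀⊆Z closed = S₀⊆Z a a∈S₀

  Chosen : System → Word → Word → Set
  Chosen S a₁ b = Elem a₁ S b × (∀ x n m → Elem a₁ S x → Code b n → Code x m → n ≼ m)

  -- A nonempty set has an element of least code: take the least element
  -- of the system of codes of its elements.  Only this specification of the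
  -- choice is ever used, so the construction is kept abstract.
  abstract
    chooseLeast : ∀ S a₁ → Σ Word (Elem a₁ S) → Σ Word (Chosen S a₁)
    chooseLeast S a₁ (x , x∈)
      with comprehension (∃w ((((var 0 ⊙ var 2) ⊙ var 3) ∈ᵛ 2) ∧ᶠ ((var 1 ∈ᵛ 0) ∧ᶠ (((var 0 ⊙ var 2) ⊙ var 1) ∈ᵛ 1))))
                         (e₀ ∷ₑ (a₁ ∷ₑ noWords)) (PowerSys ∷ₑ (H ∷ₑ (S ∷ₑ noSystems)))
    ... | Codes , Codes⇔
      with leastElement em Codes (λ m m∈ → proj₁ (proj₂ (proj₂ (proj₁ (Codes⇔ m) m∈))))
                        (proj₁ (codeTotal x) , proj₂ (Codes⇔ _) (x , x∈ , proj₂ (codeTotal x)))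
    ... | n₀ , n₀∈ , least with proj₁ (Codes⇔ n₀) n₀∈
    ... | x₀ , x₀∈ , c₀ = x₀ , x₀∈ , λ y n m y∈ cn cm →
            subst (_≼ m) (codeFunctional x₀ n₀ n c₀ cn) (least m (proj₂ (Codes⇔ m) (y , y∈ , cm)))

  chosenUnique : ∀ S a₁ b b' → Chosen S a₁ b → Chosen S a₁ b' → b ≡ b'
  chosenUnique S a₁ b b' (b∈ , bLeast) (b'∈ , b'Least) with codeTotal b | codeTotal b'
  ... | n , cn | n' , cn' = codeInjective b b' n cn (subst (Code b') (sym n≡n') cn')
    where
    n≡n' : n ≡ n'
    n≡n' = ≼-antisym n n' (bLeast b' n n' b'∈ cn cn') (b'Least b n' n b∈ cn' cn)

  -- Formulas for the graph system.  Term positions are shifted under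
  -- binders by sh; system variables 0, 1, 2 denote the powers, H and S.
  sh : Term → Term
  sh (var i) = var (suc i)
  sh zer = zer
  sh one = one
  sh (t ⊙ u) = sh t ⊙ sh u

  sh3 : Term → Term
  sh3 t = sh (sh (sh t))

  CodeF : Term → Term → Term → Formula
  CodeF t n e = (n ∈ᵛ 0) ∧ᶠ (((t ⊙ e) ⊙ n) ∈ᵛ 1)

  ElemF : Term → Term → Term → Formula
  ElemF r x e = ((x ⊙ e) ⊙ r) ∈ᵛ 2

  ≼F : Term → Term → Formula
  ≼F n m = (m ≐ n) ∨ᶠ ∃w ((var 0 ∈ᵛ 0) ∧ᶠ (sh m ≐ (sh n ⊙ var 0)))

  ChosenF : Term → Term → Term → Formula
  ChosenF a₁ b e = ElemF a₁ b e ∧ᶠ ∀w (∀w (∀w (ElemF (sh3 a₁) (var 2) (sh3 e) ⇒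
    (CodeF (sh3 b) (var 1) (sh3 e) ⇒ (CodeF (var 2) (var 0) (sh3 e) ⇒ ≼F (var 1) (var 0))))))

  -- With word parameters e₀, a, r (variables 1, 2, 3) the graph formula
  -- says: w = ((n e₀) e₀) a for a code n of an element of (r)_S, or
  -- w = (x e₀)(n e₀) with x the element a₁ or a₁ b, b chosen, of the pair n e₀.
  GraphF : Formula
  GraphF =
    (∃w (∃w ((var 2 ≐ (((var 1 ⊙ var 3) ⊙ var 3) ⊙ var 4)) ∧ᶠ
             (CodeF (var 0) (var 1) (var 3) ∧ᶠ ElemF (var 5) (var 0) (var 3)))))
    ∨ᶠ (∃w (∃w (∃w ((var 3 ≐ ((var 0 ⊙ var 4) ⊙ (var 2 ⊙ var 4))) ∧ᶠ (CodeF (var 1) (var 2) (var 4) ∧ᶠ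
         (ElemF (var 6) (var 1) (var 4) ∧ᶠ ((var 0 ≐ var 1) ∨ᶠ
           ∃w (ChosenF (var 2) (var 0) (var 5) ∧ᶠ (var 1 ≐ (var 2 ⊙ var 0))))))))))

  module Graph (s : SetOver) (nonEmpty : ∀ s₁ → Elem (rep s) (ctx s) s₁ → Σ Word λ x → Elem s₁ (ctx s) x) where
    S : System
    S = ctx s

    InPair : Word → Word → Set
    InPair a₁ x = x ≡ a₁ ⊎ Σ Word λ b → Chosen S a₁ b × x ≡ a₁ · b

    GraphWord : Word → Set
    GraphWord w =
      (Σ Word λ n → Σ Word λ a₁ → (w ≡ ((n · e₀) · e₀) · a) × Code a₁ n × Elem (rep s) S a₁) ⊎
      (Σ Word λ n → Σ Word λ a₁ → Σ Word λ x →
        (w ≡ (x · e₀) · (n · e₀)) × Code a₁ n × Elem (rep s) S a₁ × InPair a₁ x)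

    graphSystem : Σ System λ F → ∀ w → (w ∈ F ⇔ GraphWord w)
    graphSystem = comprehension GraphF (e₀ ∷ₑ (a ∷ₑ (rep s ∷ₑ noWords))) (PowerSys ∷ₑ (H ∷ₑ (S ∷ₑ noSystems)))

    F : System
    F = proj₁ graphSystem

    fromGraph : ∀ w → w ∈ F → GraphWord w
    fromGraph w = proj₁ (proj₂ graphSystem w)

    intoGraph : ∀ w → GraphWord w → w ∈ F
    intoGraph w = proj₂ (proj₂ graphSystem w)

    graphElement : ∀ c → Elem a F c → Σ Word λ n → Σ Word λ a₁ → c ≡ n · e₀ × Code a₁ n × Elem (rep s) S a₁
    graphElement c c∈ with fromGraph _ c∈
    ... | inj₁ (n , a₁ , eq , cn , a₁∈) = n , a₁ , cancelʳ c (n · e₀) e₀ (cancelʳ (c · e₀) ((n · e₀) · e₀) a eq) , cn , a₁∈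
    ... | inj₂ (n , _ , x , eq , _) = ⊥-elim (e₀-separates-a ((x · e₀) · n) (c · e₀) (trans (assoc (x · e₀) n e₀) (sym eq)))

    pairElements : ∀ n a₁ → Code a₁ n → Elem (rep s) S a₁ → ∀ x → (Elem (n · e₀) F x ⇔ InPair a₁ x)
    pairElements n a₁ cn a₁∈ x = toPair , λ p → intoGraph _ (inj₂ (n , a₁ , x , refl , cn , a₁∈ , p))
      where
      toPair : Elem (n · e₀) F x → InPair a₁ x
      toPair x∈ with fromGraph _ x∈
      ... | inj₁ (n' , _ , eq , _) =
        ⊥-elim (e₀-separates-a ((x · e₀) · n) ((n' · e₀) · e₀) (trans (assoc (x · e₀) n e₀) eq))
      ... | inj₂ (n' , a' , x' , eq , cn' , _ , p)
        with readCoded x x' n n' (proj₁ cn) (proj₁ cn')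
               (cancelʳ _ _ e₀ (trans (assoc (x · e₀) n e₀) (trans eq (sym (assoc (x' · e₀) n' e₀)))))
      ...   | refl , refl with codeInjective a' a₁ n cn' cn
      ...     | refl = p

    graphPair : ∀ n a₁ b → Code a₁ n → Elem (rep s) S a₁ → Chosen S a₁ b → Associates (n · e₀) F a₁ b
    graphPair n a₁ b cn a₁∈ chosen x = fromPair ∘ proj₁ (pairElements n a₁ cn a₁∈ x) , proj₂ (pairElements n a₁ cn a₁∈ x) ∘ toPair
      where
      fromPair : InPair a₁ x → x ≡ a₁ ⊎ x ≡ a₁ · b
      fromPair (inj₁ eq) = inj₁ eq
      fromPair (inj₂ (b' , chosen' , eq)) = inj₂ (trans eq (cong (a₁ ·_) (chosenUnique S a₁ b' b chosen' chosen)))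

      toPair : x ≡ a₁ ⊎ x ≡ a₁ · b → InPair a₁ x
      toPair (inj₁ eq) = inj₁ eq
      toPair (inj₂ eq) = inj₂ (b , chosen , eq)

    graphPairs : ∀ c a₁ b₁ → Elem a F c → Associates c F a₁ b₁ →
                 Σ Word λ n → c ≡ n · e₀ × Code a₁ n × Chosen S a₁ b₁
    graphPairs c a₁ b₁ c∈ A with graphElement c c∈
    ... | n , a' , refl , cn , a'∈ with chooseLeast S a' (nonEmpty a' a'∈)
    ...   | b , chosen with associatesUnique A (graphPair n a' b cn a'∈ chosen)
    ...     | refl , refl = n , refl , cn , chosen

    -- The target: all words, as the set (a)_U.
    U : System
    U = proj₁ (comprehension (var 0 ≐ var 0) noWords noSystems)

    everyWordIn-U : ∀ x → x ∈ U
    everyWordIn-U x = proj₂ (proj₂ (comprehension (var 0 ≐ var 0) noWords noSystems) x) refl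

    t f : SetOver
    t = ⟨ a ⟩[ U ]∶ overA
    f = ⟨ a ⟩[ F ]∶ overA

    isFunction : IsFunction f s t
    isFunction = (pairsOf-s×t , pairsDistinct) , λ a₁ a₁∈ → valueExists a₁ a₁∈ , valueUnique a₁
      where
      pairsOf-s×t : ∀ c → Elem a F c → Σ Word λ a₁ → Σ Word λ b₁ →
                    Elem (rep s) S a₁ × Elem a U b₁ × Associates c F a₁ b₁
      pairsOf-s×t c c∈ with graphElement c c∈
      ... | n , a₁ , refl , cn , a₁∈ with chooseLeast S a₁ (nonEmpty a₁ a₁∈)
      ...   | b , chosen = a₁ , b , a₁∈ , everyWordIn-U _ , graphPair n a₁ b cn a₁∈ chosen

      pairsDistinct : ∀ c₁ c₂ a₁ b₁ → Elem a F c₁ → Elem a F c₂ → Associates c₁ F a₁ b₁ → Associates c₂ F a₁ b₁ → c₁ ≡ c₂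
      pairsDistinct c₁ c₂ a₁ b₁ c₁∈ c₂∈ A₁ A₂ with graphPairs c₁ a₁ b₁ c₁∈ A₁ | graphPairs c₂ a₁ b₁ c₂∈ A₂
      ... | n₁ , refl , cn₁ , _ | n₂ , refl , cn₂ , _ = cong (_· e₀) (codeFunctional a₁ n₁ n₂ cn₁ cn₂)

      valueExists : ∀ a₁ → Elem (rep s) S a₁ → Σ Word λ b₁ → PairIn a₁ b₁ a F
      valueExists a₁ a₁∈ with codeTotal a₁ | chooseLeast S a₁ (nonEmpty a₁ a₁∈)
      ... | n , cn | b , chosen = b , n · e₀ , intoGraph _ (inj₁ (n , a₁ , refl , cn , a₁∈)) , graphPair n a₁ b cn a₁∈ chosen

      valueUnique : ∀ a₁ b₁ b₂ → PairIn a₁ b₁ a F → PairIn a₁ b₂ a F → b₁ ≡ b₂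
      valueUnique a₁ b₁ b₂ (y₁ , y₁∈ , A₁) (y₂ , y₂∈ , A₂) =
        chosenUnique S a₁ b₁ b₂ (proj₂ (proj₂ (proj₂ (graphPairs y₁ a₁ b₁ y₁∈ A₁))))
                                (proj₂ (proj₂ (proj₂ (graphPairs y₂ a₁ b₂ y₂∈ A₂))))

    selects : ∀ s₁ b₁ → Elem (rep s) S s₁ → PairIn s₁ b₁ (rep f) (ctx f) → Elem s₁ S b₁
    selects s₁ b₁ _ (y , y∈ , A) = proj₁ (proj₂ (proj₂ (proj₂ (graphPairs y s₁ b₁ y∈ A))))

mainTheorem3 : (M : Model) → ExcludedMiddle 0ℓ →
    let open Sets M in
    (e₀ : Word) (S₀ : System) → SetFoundation e₀ S₀ →
    let open OverFoundation e₀ S₀ in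
    (s : SetOver) →
    (∀ s₁ → Elem (rep s) (ctx s) s₁ → Σ Word λ x → Elem s₁ (ctx s) x) →
    Σ SetOver λ t → Σ SetOver λ f →
    IsFunction f s t ×
    (∀ s₁ b₁ → Elem (rep s) (ctx s) s₁ → PairIn s₁ b₁ (rep f) (ctx f) →
    Elem s₁ (ctx s) b₁)
mainTheorem3 M em e₀ S₀ foundation s nonEmpty = t , f , isFunction , selects
  where
  open Selection M em e₀ S₀ foundation
  open Graph s nonEmpty
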